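{- Let $G_1,G_2$ be finite simple graphs, and for $i=1,2$ let $\mathcal G_i$ be a gadget in $G_i$ with parameter tuple $(a_i,t_i,s_i,o_i,h_i,v_i)$, code $I_i$, transversals $P^{\mathrm H}_i,P^{\mathrm V}_i$, auxiliary set $X_i=O_i\mathbin{\dot\cup}H_i\mathbin{\dot\cup}V_i$, set of centers $R_i$, and $B_i=I_i\setminus R_i$. Define the set-valued map $L_1:X_2\to 2^{V(G_1)}$ by $$L_1(x)=\begin{cases}R_1,&x\in O_2,\\ P^{\mathrm H}_1,&x\in H_2,\\ P^{\mathrm V}_1,&x\in V_2,\end{cases}$$ and the set-valued map $K_2:X_1\to 2^{V(G_2)}$ by $$K_2(y)=\begin{cases}R_2,&y\in O_1,\\ P^{\mathrm V}_2,&y\in H_1,\\ P^{\mathrm H}_2,&y\in V_1.\end{cases}$$ Define $$A_H=\{(p,x):x\in X_2,\ p\in L_1(x)\},\qquad A_V=\{(y,q):y\in X_1,\ q\in K_2(y)\},$$ $$I_{12}=(B_1\times B_2)\cup A_H\cup A_V.$$ Then $I_{12}$ is an independent set in the strong product $G_1\boxtimes G_2$ and $$a_{12}=|I_{12}|=(a_1-t_1)(a_2-t_2)+t_1s_2+s_1t_2.$$ Moreover, $I_{12}$ is the code of a gadget $\mathcal G_{12}$ in $G_1\boxtimes G_2$ with parameter tuple $(a_{12},t_{12},s_{12},o_{12},h_{12},v_{12})$, where $$t_{12}=t_1o_2+o_1t_2,$$ $$s_{12}=s_1s_2,$$ $$o_{12}=o_1o_2+(h_1+v_1)(h_2+v_2),$$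 $$h_{12}=h_1o_2+o_1v_2,$$ $$v_{12}=v_1o_2+o_1h_2.$$
   Context: For vertices $u,v$ of a graph $G$, write $u\simeq v$ (and say $u$ and $v$ are confusable) if $u=v$ or $\{u,v\}\in E(G)$. For $S\subseteq V(G)$, let $N(S)=\{x\in V(G): x\simeq s\text{ for some }s\in S\}$ be the closed neighborhood of $S$. The strong product $G_1\boxtimes G_2$ has vertex set $V(G_1)\times V(G_2)$ and satisfies $(x_1,x_2)\simeq(y_1,y_2)$ if and only if $x_1\simeq y_1$ and $x_2\simeq y_2$. Private pair: let $I$ be an independent set in $G$. A pair $(r,q)$ of vertices is a private pair for $I$ if $r\in I$, $q\notin I$, and $N(\{q\})\cap I=\{r\}$. The point $r$ is the center, $q$ is its private neighbor, and both are called endpoints of the private pair. Gadget: a gadget in $G$ consists of the following data. (1) An independent set $I\subseteq V(G)$ of size $a$, called the code of the gadget. (2) Private pairs $(r_i,q_i)$, $1\le i\le t$, for $I$ with pairwise disjoint endpoint sets $\{r_i,q_i\}$ (hence with distinct centers). (3) Two complementary transversals $P^{\mathrm H},P^{\mathrm V}$ of the pair endpoints: $P^{\mathrm H}$ and $P^{\mathrm V}$ consist of pair endpoints, and for every $i$, one of $r_i,q_i$ belongs to $P^{\mathrm H}$ and the other belongs to $P^{\mathrm V}$ (so $|P^{\mathrm H}|=|P^{\mathrm V}|=t$). Both $P^{\mathrm H}$ and $P^{\mathrm V}$ are independent in $G$. (4) An independent set $X$ of $G$ (the auxiliary set) such that $X\cap N(P^{\mathrm H})\cap N(P^{\mathrm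 V})=\emptyset$. Write $O=X\setminus(N(P^{\mathrm H})\cup N(P^{\mathrm V}))$, $H=X\cap N(P^{\mathrm H})$, $V=X\cap N(P^{\mathrm V})$, and $(s,o,h,v)=(|X|,|O|,|H|,|V|)$. Thus $X=O\mathbin{\dot\cup}H\mathbin{\dot\cup}V$ and $s=o+h+v$. The tuple $(a,t,s,o,h,v)$ is the parameter tuple of the gadget. Further, $R=\{r_1,\ldots,r_t\}$ denotes the set of centers and $B=I\setminus R$. Subscripts $1,2$ refer to the data of the gadgets in $G_1,G_2$. -}

module Defs where

open import Data.Fin using (Fin)
import Data.Fin.Properties as Fin
open import Data.List using (List; length; filter; cartesianProduct)
import Data.List.Membership.Propositional as List
open import Data.List.Membership.Propositional.Properties using (∈-cartesianProduct⁺)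
open import Data.List.Relation.Unary.Any using (any?; satisfied)
open import Data.List.Relation.Unary.Unique.Propositional using (Unique)
open import Data.List.Relation.Unary.Unique.Propositional.Properties using (cartesianProduct⁺)
open import Data.Nat using (ℕ)
open import Data.Product using (_×_; _,_; ∃-syntax; proj₁; proj₂)
open import Data.Product.Properties using (≡-dec)
open import Data.Sum using (_⊎_; inj₁; inj₂)
open import Function using (_∘_; _⇔_; mk⇔)
open import Level using (0ℓ)
open import Relation.Binary using (Rel; DecidableEquality; Symmetric; Irreflexive)
  renaming (Decidable to Decidable₂)
open import Relation.Binary.PropositionalEquality using (_≡_; _≢_; refl; sym; cong)
open import Relation.Nullary using (¬_; yes; no)
open import Relation.Nullary.Decidable using (map′; ¬?; _×-dec_; _⊎-dec_)
open import Relation.Unary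
  using (Pred; Decidable; _∈_; _∉_; _∪_; _∩_; _∖_; _≐_; _⊥_; Empty; ｛_｝; _⟨×⟩_)
open import Relation.Unary.Properties using (_∪?_; _∩?_; ∁?; _×?_)

-- A finite vertex type is given by a duplicate-free list of all its elements.
-- Subsets of it are decidable predicates.
record FiniteSimpleGraph : Set₁ where
  infix 4 _≟_ _≃_ _≃?_
  field
    Vertex     : Set
    _≟_        : DecidableEquality Vertex
    vertices   : List Vertex
    unique     : Unique vertices
    complete   : ∀ x → x List.∈ vertices
    Adj        : Rel Vertex 0ℓ
    adj?       : Decidable₂ Adj
    adj-sym    : Symmetric Adj
    adj-irrefl : Irreflexive _≡_ Adj

  _≃_ : Rel Vertex 0ℓ
  u ≃ v = u ≡ v ⊎ Adj u v

  _≃?_ : Decidable₂ _≃_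
  u ≃? v = (u ≟ v) ⊎-dec adj? u v

  N : Pred Vertex 0ℓ → Pred Vertex 0ℓ
  N S x = ∃[ s ] s ∈ S × x ≃ s

  N? : ∀ {S} → Decidable S → Decidable (N S)
  N? S? x = map′ satisfied (λ (s , p) → List.lose (complete s) p)
                 (any? (λ s → S? s ×-dec (x ≃? s)) vertices)

  Independent : Pred Vertex 0ℓ → Set
  Independent S = ∀ {x y} → x ∈ S → y ∈ S → ¬ Adj x y

  ∣_∣ : ∀ {S : Pred Vertex 0ℓ} → Decidable S → ℕ
  ∣ S? ∣ = length (filter S? vertices)

  PrivatePair : Pred Vertex 0ℓ → Vertex → Vertex → Set
  PrivatePair I r q = r ∈ I × q ∉ I × (N ｛ q ｝ ∩ I) ≐ ｛ r ｝

infixr 2 _⊠_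

_⊠_ : FiniteSimpleGraph → FiniteSimpleGraph → FiniteSimpleGraph
G₁ ⊠ G₂ = record
  { Vertex     = G₁.Vertex × G₂.Vertex
  ; _≟_        = _≟_
  ; vertices   = cartesianProduct G₁.vertices G₂.vertices
  ; unique     = cartesianProduct⁺ G₁.unique G₂.unique
  ; complete   = λ (x₁ , x₂) → ∈-cartesianProduct⁺ (G₁.complete x₁) (G₂.complete x₂)
  ; Adj        = λ x y → x ≢ y × proj₁ x G₁.≃ proj₁ y × proj₂ x G₂.≃ proj₂ y
  ; adj?       = λ x y → ¬? (x ≟ y) ×-dec (proj₁ x G₁.≃? proj₁ y) ×-dec (proj₂ x G₂.≃? proj₂ y)
  ; adj-sym    = λ (x≢y , c₁ , c₂) → x≢y ∘ sym , flip G₁.adj-sym c₁ , flip G₂.adj-sym c₂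
  ; adj-irrefl = λ x≡y (x≢y , _) → x≢y x≡y
  }
  where
  module G₁ = FiniteSimpleGraph G₁
  module G₂ = FiniteSimpleGraph G₂

  _≟_ : DecidableEquality (G₁.Vertex × G₂.Vertex)
  _≟_ = ≡-dec G₁._≟_ G₂._≟_

  flip : ∀ {A : Set} {R : Rel A 0ℓ} → Symmetric R → ∀ {x y} → x ≡ y ⊎ R x y → y ≡ x ⊎ R y x
  flip R-sym (inj₁ e) = inj₁ (sym e)
  flip R-sym (inj₂ a) = inj₂ (R-sym a)

module _ (G₁ G₂ : FiniteSimpleGraph) where
  private
    module G₁ = FiniteSimpleGraph G₁
    module G₂ = FiniteSimpleGraph G₂
    module G  = FiniteSimpleGraph (G₁ ⊠ G₂)

  ⊠-≃ : ∀ {x y} → x G.≃ y ⇔ (proj₁ x G₁.≃ proj₁ y × proj₂ x G₂.≃ proj₂ y)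
  ⊠-≃ {x} {y} = mk⇔ to from
    where
    to : x G.≃ y → proj₁ x G₁.≃ proj₁ y × proj₂ x G₂.≃ proj₂ y
    to (inj₁ e)       = inj₁ (cong proj₁ e) , inj₁ (cong proj₂ e)
    to (inj₂ (_ , c)) = c

    from : proj₁ x G₁.≃ proj₁ y × proj₂ x G₂.≃ proj₂ y → x G.≃ y
    from c with x G.≟ y
    ... | yes e = inj₁ e
    ... | no ¬e = inj₂ (¬e , c)

record Gadget (G : FiniteSimpleGraph) : Set₁ where
  open FiniteSimpleGraph G
  field
    I             : Pred Vertex 0ℓ
    I?            : Decidable I
    I-independent : Independent I

    t            : ℕ
    r q          : Fin t → Vertex
    private-pair : ∀ i → PrivatePair I (r i) (q i)

  Endpoints : Fin t → Pred Vertex 0ℓ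
  Endpoints i = ｛ r i ｝ ∪ ｛ q i ｝

  field
    endpoints-disjoint : ∀ {i j} → i ≢ j → Endpoints i ⊥ Endpoints j

    PH PV          : Pred Vertex 0ℓ
    PH?            : Decidable PH
    PV?            : Decidable PV
    PH-endpoints   : ∀ {x} → x ∈ PH → ∃[ i ] x ∈ Endpoints i
    PV-endpoints   : ∀ {x} → x ∈ PV → ∃[ i ] x ∈ Endpoints i
    -- No pair has both endpoints in the same transversal, since r i and q i
    -- are adjacent and PH and PV are independent.
    transversal    : ∀ i → (r i ∈ PH × q i ∈ PV) ⊎ (q i ∈ PH × r i ∈ PV)
    PH-independent : Independent PH
    PV-independent : Independent PV

    X             : Pred Vertex 0ℓ
    X?            : Decidable X
    X-independent : Independent X
    X-separated   : Empty (X ∩ N PH ∩ N PV)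

  O H V R B : Pred Vertex 0ℓ
  O = X ∖ (N PH ∪ N PV)
  H = X ∩ N PH
  V = X ∩ N PV
  R x = ∃[ i ] r i ≡ x
  B = I ∖ R

  O? : Decidable O
  O? = X? ∩? ∁? (N? PH? ∪? N? PV?)

  H? : Decidable H
  H? = X? ∩? N? PH?

  V? : Decidable V
  V? = X? ∩? N? PV?

  R? : Decidable R
  R? x = Fin.any? (λ i → r i ≟ x)

  B? : Decidable B
  B? = I? ∩? ∁? R?

  -- (a , t , s , o , h , v)
  parameters : ℕ × ℕ × ℕ × ℕ × ℕ × ℕ
  parameters = ∣ I? ∣ , t , ∣ X? ∣ , ∣ O? ∣ , ∣ H? ∣ , ∣ V? ∣

module Product {G₁ G₂ : FiniteSimpleGraph} (𝒢₁ : Gadget G₁) (𝒢₂ : Gadget G₂) where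
  private
    module G₁ = FiniteSimpleGraph G₁
    module G₂ = FiniteSimpleGraph G₂
    module 𝒢₁ = Gadget 𝒢₁
    module 𝒢₂ = Gadget 𝒢₂

  -- Set-valued maps defined by cases on the partition of X into O, H and V,
  -- written as disjunctions over the cases; only their values on X are used.
  L₁ : G₂.Vertex → Pred G₁.Vertex 0ℓ
  L₁ x p = (x ∈ 𝒢₂.O × p ∈ 𝒢₁.R) ⊎ (x ∈ 𝒢₂.H × p ∈ 𝒢₁.PH) ⊎ (x ∈ 𝒢₂.V × p ∈ 𝒢₁.PV)

  -- H and V are paired with the opposite transversals here.
  K₂ : G₁.Vertex → Pred G₂.Vertex 0ℓ
  K₂ y q = (y ∈ 𝒢₁.O × q ∈ 𝒢₂.R) ⊎ (y ∈ 𝒢₁.H × q ∈ 𝒢₂.PV) ⊎ (y ∈ 𝒢₁.V × q ∈ 𝒢₂.PH)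

  A-H A-V I₁₂ : Pred (G₁.Vertex × G₂.Vertex) 0ℓ
  A-H (p , x) = x ∈ 𝒢₂.X × p ∈ L₁ x
  A-V (y , q) = y ∈ 𝒢₁.X × q ∈ K₂ y
  I₁₂ = (𝒢₁.B ⟨×⟩ 𝒢₂.B) ∪ A-H ∪ A-V

  L₁? : ∀ x → Decidable (L₁ x)
  L₁? x p = (𝒢₂.O? x ×-dec 𝒢₁.R? p) ⊎-dec (𝒢₂.H? x ×-dec 𝒢₁.PH? p) ⊎-dec (𝒢₂.V? x ×-dec 𝒢₁.PV? p)

  K₂? : ∀ y → Decidable (K₂ y)
  K₂? y q = (𝒢₁.O? y ×-dec 𝒢₂.R? q) ⊎-dec (𝒢₁.H? y ×-dec 𝒢₂.PV? q) ⊎-dec (𝒢₁.V? y ×-dec 𝒢₂.PH? q)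

  A-H? : Decidable A-H
  A-H? (p , x) = 𝒢₂.X? x ×-dec L₁? x p

  A-V? : Decidable A-V
  A-V? (y , q) = 𝒢₁.X? y ×-dec K₂? y q

  I₁₂? : Decidable I₁₂
  I₁₂? = (𝒢₁.B? ×? 𝒢₂.B?) ∪? (A-H? ∪? A-V?)

{-# OPTIONS --safe #-}
module Submission where

-- Every vertex confusable with an endpoint of a private pair avoids B and O, and inside X
-- it belongs to the class, H or V, of the transversals containing that endpoint.  Hence a
-- vertex (p , x) of A-H confusable with (y , q) of A-V would have x and y outside O, with y
-- in the class of the transversal of p, which is the class of x, and x in the opposite class
-- of y: this is where the swap of the transversals in K₂ enters.
-- The product gadget has auxiliary set X₁ × X₂ and private pairs (r₁ , x)–(q₁ , x) with
-- x ∈ O₂ and (y , r₂)–(y , q₂) with y ∈ O₁, split into the transversals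
-- P₁ᴴ × O₂ ∪ O₁ × P₂ⱽ and P₁ⱽ × O₂ ∪ O₁ × P₂ᴴ.

open import Defs
open import Data.Fin using (Fin; zero; suc)
import Data.Fin.Properties as Fin
open import Data.List using (List; []; _∷_; length; lookup; map; tabulate; filter; cartesianProduct)
import Data.List.Membership.Propositional as List
open import Data.List.Membership.Propositional.Properties
  using (∈-filter⁺; ∈-filter⁻; ∈-++⁺ˡ; ∈-++⁺ʳ; ∈-++⁻; ∈-cartesianProduct⁺; ∈-cartesianProduct⁻;
         ∈-tabulate⁺; ∈-tabulate⁻; ∈-lookup)
open import Data.List.Membership.Propositional.Properties.WithK using (unique∧set⇒bag)
open import Data.List.Properties using (length-++; length-map; length-tabulate)
open import Data.List.Relation.Binary.BagAndSetEquality using (∼bag⇒↭)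
open import Data.List.Relation.Binary.Permutation.Propositional.Properties using (↭-length)
import Data.List.Relation.Unary.All as All
open import Data.List.Relation.Unary.AllPairs using (_∷_)
open import Data.List.Relation.Unary.Any using (index)
open import Data.List.Relation.Unary.Any.Properties using (lookup-index)
open import Data.List.Relation.Unary.Unique.Propositional using (Unique)
open import Data.List.Relation.Unary.Unique.Propositional.Properties
  using (filter⁺; ++⁺; tabulate⁺; cartesianProduct⁺)
open import Data.Nat using (ℕ; _+_; _*_; _∸_)
open import Data.Nat.Properties using (+-cancelʳ-≡; m+n∸n≡m)
open import Data.Nat.Tactic.RingSolver using (solve-∀)
open import Data.Product using (_×_; _,_; ∃-syntax; proj₁; proj₂)
open import Data.Sum using (_⊎_; inj₁; inj₂; [_,_]′)
open import Data.Sum.Function.Propositional using (_⊎-↔_)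
open import Function using (_∘_; id; _⇔_; _↔_; mk⇔; Equivalence; Inverse; Injection; Injective)
open import Function.Construct.Composition using (_↔-∘_)
open import Function.Properties.Inverse using (↔⇒↣)
open import Level using (0ℓ)
open import Relation.Binary.PropositionalEquality
  using (_≡_; _≢_; refl; sym; trans; cong; cong₂; subst; module ≡-Reasoning)
open import Relation.Nullary using (¬_; yes; no; contradiction)
open import Relation.Nullary.Decidable using (decidable-stable)
open import Relation.Unary
  using (Pred; Decidable; _∈_; _∉_; _∪_; _∩_; _⊆_; _≐_; _⊥_; ｛_｝; _⟨×⟩_)
open import Relation.Unary.Properties using (_∪?_; _×?_)

-- Lists: lengths of products and positions in duplicate-free lists.

length-cartesianProduct : ∀ {A B : Set} (xs : List A) (ys : List B) →
                          length (cartesianProduct xs ys) ≡ length xs * length ys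
length-cartesianProduct []       ys = refl
length-cartesianProduct (x ∷ xs) ys =
  trans (length-++ (map (x ,_) ys))
        (cong₂ _+_ (length-map (x ,_) ys) (length-cartesianProduct xs ys))

lookup-injective : ∀ {A : Set} {xs : List A} → Unique xs → Injective _≡_ _≡_ (lookup xs)
lookup-injective (_ ∷ _) {zero}  {zero}  _ = refl
lookup-injective (x∉ ∷ _) {zero}  {suc j} e = contradiction e (All.lookup x∉ (∈-lookup j))
lookup-injective (x∉ ∷ _) {suc i} {zero}  e = contradiction (sym e) (All.lookup x∉ (∈-lookup i))
lookup-injective (_ ∷ u) {suc i} {suc j} e = cong suc (lookup-injective u e)

-- The three classes of the auxiliary set and the exchange of H and V.

data Kind : Set where
  o h v : Kind

swap : Kind → Kind
swap o = o
swap h = v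
swap v = h

swap≢o : ∀ {k} → k ≢ o → swap k ≢ o
swap≢o {o} k≢o _ = k≢o refl
swap≢o {h} _   ()
swap≢o {v} _   ()

-- Neither `h` nor `v` is its own image; this is the contradiction that keeps horizontal and
-- vertical points of the code apart.
swap-fixed : ∀ {k} → swap k ≡ k → k ≡ o
swap-fixed {o} _ = refl

⋃ : ∀ {A : Set} → (Kind → Pred A 0ℓ) → Pred A 0ℓ
⋃ P x = ∃[ k ] x ∈ P k

-- Independence and counting in a finite graph.

module GraphProperties (G : FiniteSimpleGraph) where
  open FiniteSimpleGraph G

  private variable
    S T U : Pred Vertex 0ℓ

  ≃-refl : ∀ {x} → x ≃ x
  ≃-refl = inj₁ refl

  ≃-sym : ∀ {x y} → x ≃ y → y ≃ x
  ≃-sym (inj₁ e) = inj₁ (sym e)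
  ≃-sym (inj₂ a) = inj₂ (adj-sym a)

  -- Independence is handled in this form because `≃` splits coordinatewise in a strong product,
  -- whereas adjacency of pairs carries an inequation that does not.
  independent⇒≡ : Independent S → ∀ {x y} → x ∈ S → y ∈ S → x ≃ y → x ≡ y
  independent⇒≡ ind x∈ y∈ (inj₁ e) = e
  independent⇒≡ ind x∈ y∈ (inj₂ a) = contradiction a (ind x∈ y∈)

  ≡⇒independent : (∀ {x y} → x ∈ S → y ∈ S → x ≃ y → x ≡ y) → Independent S
  ≡⇒independent f x∈ y∈ a = adj-irrefl (f x∈ y∈ (inj₂ a)) a

  filter-∈ : (S? : Decidable S) → ∀ {x} → x List.∈ filter S? vertices → x ∈ S
  filter-∈ S? = proj₂ ∘ ∈-filter⁻ S? {xs = vertices}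

  ∈-filter : (S? : Decidable S) → ∀ {x} → x ∈ S → x List.∈ filter S? vertices
  ∈-filter S? = ∈-filter⁺ S? (complete _)

  -- Duplicate-free lists with the same members are permutations of each other. Every count below
  -- goes back to this.
  card-list : (S? : Decidable S) {xs : List Vertex} → Unique xs →
              (∀ {x} → x List.∈ xs ⇔ x ∈ S) → ∣ S? ∣ ≡ length xs
  card-list S? u eq = ↭-length (∼bag⇒↭ (unique∧set⇒bag (filter⁺ S? unique) u
    (mk⇔ (Equivalence.from eq ∘ filter-∈ S?) (∈-filter S? ∘ Equivalence.to eq))))

  card-∪ : (S? : Decidable S) (T? : Decidable T) (U? : Decidable U) →
           S ≐ T ∪ U → T ⊥ U → ∣ S? ∣ ≡ ∣ T? ∣ + ∣ U? ∣
  card-∪ S? T? U? (S⊆ , ⊆S) T⊥U =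
    trans (card-list S? (++⁺ (filter⁺ T? unique) (filter⁺ U? unique)
                             λ (x∈T , x∈U) → T⊥U (filter-∈ T? x∈T , filter-∈ U? x∈U))
            (mk⇔ (⊆S ∘ [ inj₁ ∘ filter-∈ T? , inj₂ ∘ filter-∈ U? ]′ ∘ ∈-++⁻ (filter T? vertices))
                 ([ ∈-++⁺ˡ ∘ ∈-filter T? , ∈-++⁺ʳ (filter T? vertices) ∘ ∈-filter U? ]′ ∘ S⊆)))
          (length-++ (filter T? vertices))

  card-⋃ : (S? : Decidable S) {P : Kind → Pred Vertex 0ℓ} (P? : ∀ k → Decidable (P k)) →
           S ≐ ⋃ P → (∀ k l {x} → x ∈ P k → x ∈ P l → k ≡ l) →
           ∣ S? ∣ ≡ ∣ P? o ∣ + ∣ P? h ∣ + ∣ P? v ∣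
  card-⋃ {S} S? {P} P? (S⊆ , ⊆S) unique-kind =
    trans (card-∪ S? (P? o ∪? P? h) (P? v) (split , join) disjoint)
          (cong (_+ ∣ P? v ∣) (card-∪ (P? o ∪? P? h) (P? o) (P? h) (id , id)
            λ (x∈o , x∈h) → contradiction (unique-kind o h x∈o x∈h) λ ()))
    where
    split : S ⊆ (P o ∪ P h) ∪ P v
    split x∈ with S⊆ x∈
    ... | o , p = inj₁ (inj₁ p)
    ... | h , p = inj₁ (inj₂ p)
    ... | v , p = inj₂ p

    join : (P o ∪ P h) ∪ P v ⊆ S
    join (inj₁ (inj₁ p)) = ⊆S (o , p)
    join (inj₁ (inj₂ p)) = ⊆S (h , p)
    join (inj₂ p)        = ⊆S (v , p)

    disjoint : (P o ∪ P h) ⊥ P v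
    disjoint (inj₁ p , p′) = contradiction (unique-kind o v p p′) λ ()
    disjoint (inj₂ p , p′) = contradiction (unique-kind h v p p′) λ ()

  card-image : (S? : Decidable S) {n : ℕ} {f : Fin n → Vertex} → Injective _≡_ _≡_ f →
               S ≐ (λ x → ∃[ i ] f i ≡ x) → ∣ S? ∣ ≡ n
  card-image S? {f = f} f-inj (S⊆ , ⊆S) =
    trans (card-list S? (tabulate⁺ f-inj)
            (mk⇔ (λ x∈ → let (i , e) = ∈-tabulate⁻ x∈ in ⊆S (i , sym e))
                 (λ x∈ → let (i , e) = S⊆ x∈ in subst (List._∈ tabulate f) e (∈-tabulate⁺ i))))
          (length-tabulate f)

  -- Applied to O, this supplies the `Fin` indices for the copies of the private pairs in the
  -- product.
  module Enumeration (S? : Decidable S) where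
    element : Fin ∣ S? ∣ → Vertex
    element = lookup (filter S? vertices)

    element-∈ : ∀ i → element i ∈ S
    element-∈ i = filter-∈ S? (∈-lookup i)

    element-injective : Injective _≡_ _≡_ element
    element-injective = lookup-injective (filter⁺ S? unique)

    element-surjective : ∀ {x} → x ∈ S → ∃[ i ] element i ≡ x
    element-surjective x∈ = index x∈xs , sym (lookup-index x∈xs)
      where x∈xs = ∈-filter S? x∈

card-× : (G₁ G₂ : FiniteSimpleGraph) →
         let module G₁ = FiniteSimpleGraph G₁
             module G₂ = FiniteSimpleGraph G₂
             module G  = FiniteSimpleGraph (G₁ ⊠ G₂)
         in {S : Pred G₁.Vertex 0ℓ} {T : Pred G₂.Vertex 0ℓ} (S? : Decidable S) (T? : Decidable T) →
            G.∣ S? ×? T? ∣ ≡ G₁.∣ S? ∣ * G₂.∣ T? ∣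
card-× G₁ G₂ S? T? =
  trans (GraphProperties.card-list (G₁ ⊠ G₂) (S? ×? T?)
          (cartesianProduct⁺ (filter⁺ S? G₁.unique) (filter⁺ T? G₂.unique))
          (mk⇔ (λ z∈ → let (x∈ , y∈) = ∈-cartesianProduct⁻ (filter S? G₁.vertices) _ z∈
                       in G₁.filter-∈ S? x∈ , G₂.filter-∈ T? y∈)
               (λ (x∈ , y∈) → ∈-cartesianProduct⁺ (G₁.∈-filter S? x∈) (G₂.∈-filter T? y∈))))
        (length-cartesianProduct (filter S? G₁.vertices) _)
  where
  module G₁ where
    open FiniteSimpleGraph G₁ public
    open GraphProperties G₁ public
  module G₂ where
    open FiniteSimpleGraph G₂ public
    open GraphProperties G₂ public

-- Classes, endpoints and sizes in a single gadget.

module GadgetProperties {G : FiniteSimpleGraph} (𝒢 : Gadget G) where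
  open FiniteSimpleGraph G
  open GraphProperties G
  open Gadget 𝒢

  -- L₁ takes the value Label k on Part k, and K₂ the value Label (swap k).
  Part Label : Kind → Pred Vertex 0ℓ
  Part o = O
  Part h = H
  Part v = V
  Label o = R
  Label h = PH
  Label v = PV

  Part? : ∀ k → Decidable (Part k)
  Part? o = O?
  Part? h = H?
  Part? v = V?

  Label? : ∀ k → Decidable (Label k)
  Label? o = R?
  Label? h = PH?
  Label? v = PV?

  Endpoint : Pred Vertex 0ℓ
  Endpoint x = ∃[ i ] x ∈ Endpoints i

  r∈I : ∀ i → r i ∈ I
  r∈I i = proj₁ (private-pair i)

  r≢q : ∀ i → r i ≢ q i
  r≢q i e = proj₁ (proj₂ (private-pair i)) (subst I e (r∈I i))

  -- The inclusion of `｛ r i ｝` in `N ｛ q i ｝ ∩ I`, read at `r i`.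
  r≃q : ∀ i → r i ≃ q i
  r≃q i with _ , refl , c ← proj₁ (proj₂ (proj₂ (proj₂ (private-pair i))) refl) = c

  center : ∀ {i x} → x ∈ I → x ≃ q i → r i ≡ x
  center {i} x∈I c = proj₁ (proj₂ (proj₂ (private-pair i))) ((_ , refl , c) , x∈I)

  q∈Endpoint : ∀ i → q i ∈ Endpoint
  q∈Endpoint i = i , inj₂ refl

  endpoints-unique : ∀ {i j x} → x ∈ Endpoints i → x ∈ Endpoints j → i ≡ j
  endpoints-unique {i} {j} x∈i x∈j =
    decidable-stable (i Fin.≟ j) λ i≢j → endpoints-disjoint i≢j (x∈i , x∈j)

  Label⊆Endpoint : ∀ k → Label k ⊆ Endpoint
  Label⊆Endpoint o (i , e) = i , inj₁ e
  Label⊆Endpoint h = PH-endpoints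
  Label⊆Endpoint v = PV-endpoints

  Label⇒≡ : ∀ k {x y} → x ∈ Label k → y ∈ Label k → x ≃ y → x ≡ y
  Label⇒≡ o (i , refl) (j , refl) = independent⇒≡ I-independent (r∈I i) (r∈I j)
  Label⇒≡ h = independent⇒≡ PH-independent
  Label⇒≡ v = independent⇒≡ PV-independent

  X⇒≡ : ∀ {x y} → x ∈ X → y ∈ X → x ≃ y → x ≡ y
  X⇒≡ = independent⇒≡ X-independent

  Part⊆X : ∀ k → Part k ⊆ X
  Part⊆X o = proj₁
  Part⊆X h = proj₁
  Part⊆X v = proj₁

  Part⊆N-Label : ∀ {k} → k ≢ o → Part k ⊆ N (Label k)
  Part⊆N-Label {o} k≢o = contradiction refl k≢o
  Part⊆N-Label {h} _   = proj₂
  Part⊆N-Label {v} _   = proj₂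

  -- H and V are cut out of X by confusability with their labels. Kind `o` is excluded because O is
  -- what remains, not a neighborhood of R.
  ∈-Part : ∀ {k x p} → k ≢ o → x ∈ X → p ∈ Label k → x ≃ p → x ∈ Part k
  ∈-Part {o} k≢o _ _ _   = contradiction refl k≢o
  ∈-Part {h} _ x∈ p∈ c   = x∈ , _ , p∈ , c
  ∈-Part {v} _ x∈ p∈ c   = x∈ , _ , p∈ , c

  -- O lies outside both neighborhoods by definition; H and V are disjoint by `X-separated`.
  Part-unique : ∀ k l {x} → x ∈ Part k → x ∈ Part l → k ≡ l
  Part-unique o o _ _ = refl
  Part-unique o h (_ , x∉) (_ , x∈) = contradiction (inj₁ x∈) x∉
  Part-unique o v (_ , x∉) (_ , x∈) = contradiction (inj₂ x∈) x∉
  Part-unique h o (_ , x∈) (_ , x∉) = contradiction (inj₁ x∈) x∉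
  Part-unique h h _ _ = refl
  Part-unique h v (x∈X , x∈H) (_ , x∈V) = contradiction (x∈X , x∈H , x∈V) (X-separated _)
  Part-unique v o (_ , x∈) (_ , x∉) = contradiction (inj₂ x∈) x∉
  Part-unique v h (_ , x∈V) (x∈X , x∈H) = contradiction (x∈X , x∈H , x∈V) (X-separated _)
  Part-unique v v _ _ = refl

  X≐⋃Part : X ≐ ⋃ Part
  X≐⋃Part = to , λ (k , x∈) → Part⊆X k x∈
    where
    to : X ⊆ ⋃ Part
    to {x} x∈ with N? PH? x | N? PV? x
    ... | yes n | _     = h , x∈ , n
    ... | no _  | yes n = v , x∈ , n
    ... | no ¬h | no ¬v = o , x∈ , [ ¬h , ¬v ]′

  card-X : ∣ X? ∣ ≡ ∣ O? ∣ + ∣ H? ∣ + ∣ V? ∣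
  card-X = card-⋃ X? Part? X≐⋃Part Part-unique

  Endpoint⊆PH∪PV : Endpoint ⊆ PH ∪ PV
  Endpoint⊆PH∪PV (i , e) with transversal i | e
  ... | inj₁ (r∈ , q∈) | inj₁ refl = inj₁ r∈
  ... | inj₁ (r∈ , q∈) | inj₂ refl = inj₂ q∈
  ... | inj₂ (q∈ , r∈) | inj₁ refl = inj₂ r∈
  ... | inj₂ (q∈ , r∈) | inj₂ refl = inj₁ q∈

  -- The two transversals exhaust the endpoints, so avoiding both neighborhoods means avoiding
  -- centers and private neighbors alike.
  O≄Endpoint : ∀ {x p} → x ∈ O → p ∈ Endpoint → ¬ x ≃ p
  O≄Endpoint (_ , x∉) p∈ c with Endpoint⊆PH∪PV p∈
  ... | inj₁ p∈H = x∉ (inj₁ (_ , p∈H , c))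
  ... | inj₂ p∈V = x∉ (inj₂ (_ , p∈V , c))

  -- A code vertex confusable with a center equals it, and one confusable with a private neighbor is
  -- the center of that pair; either way it would lie in R.
  B≄Endpoint : ∀ {b p} → b ∈ B → p ∈ Endpoint → ¬ b ≃ p
  B≄Endpoint (b∈I , b∉R) (i , inj₁ refl) c = b∉R (i , sym (independent⇒≡ I-independent b∈I (r∈I i) c))
  B≄Endpoint (b∈I , b∉R) (i , inj₂ refl) c = b∉R (i , center b∈I c)

  -- Since r i ≃ q i and Label k is independent, no pair has both endpoints in Label k.
  card-selection : ∀ k (f : Fin t → Vertex) → (∀ i → f i ∈ Endpoints i) → (∀ i → f i ∈ Label k) →
                   ∣ Label? k ∣ ≡ t
  card-selection k f f∈E f∈L = card-image (Label? k)
    (λ {i} {j} e → endpoints-unique (f∈E i) (subst (_∈ Endpoints j) (sym e) (f∈E j)))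
    ( (λ x∈ → let (i , x∈i) = Label⊆Endpoint k x∈
              in i , Label⇒≡ k (f∈L i) x∈ (endpoints-≃ i (f∈E i) x∈i))
    , λ { (i , refl) → f∈L i })
    where
    endpoints-≃ : ∀ i {x y} → x ∈ Endpoints i → y ∈ Endpoints i → x ≃ y
    endpoints-≃ i (inj₁ refl) (inj₁ refl) = ≃-refl
    endpoints-≃ i (inj₁ refl) (inj₂ refl) = r≃q i
    endpoints-≃ i (inj₂ refl) (inj₁ refl) = ≃-sym (r≃q i)
    endpoints-≃ i (inj₂ refl) (inj₂ refl) = ≃-refl

  selection : ∀ k i → ∃[ x ] x ∈ Endpoints i × x ∈ Label k
  selection o i = r i , inj₁ refl , i , refl
  selection h i with transversal i
  ... | inj₁ (r∈ , _) = r i , inj₁ refl , r∈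
  ... | inj₂ (q∈ , _) = q i , inj₂ refl , q∈
  selection v i with transversal i
  ... | inj₁ (_ , q∈) = q i , inj₂ refl , q∈
  ... | inj₂ (_ , r∈) = r i , inj₁ refl , r∈

  -- R, `PH` and `PV` each contain one endpoint of every pair. Their common size is why the size of
  -- the product code depends on X only through its total size.
  card-Label : ∀ k → ∣ Label? k ∣ ≡ t
  card-Label k = card-selection k (proj₁ ∘ selection k) (proj₁ ∘ proj₂ ∘ selection k)
                                  (proj₂ ∘ proj₂ ∘ selection k)

  -- Since R is contained in I and has `t` elements, the truncated subtraction is exact.
  card-B : ∣ B? ∣ ≡ ∣ I? ∣ ∸ t
  card-B = sym (trans (cong₂ _∸_ (card-∪ I? B? R? (to , from) λ ((_ , x∉R) , x∈R) → x∉R x∈R)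
                                 (sym (card-Label o)))
                      (m+n∸n≡m ∣ B? ∣ ∣ R? ∣))
    where
    to : I ⊆ B ∪ R
    to {x} x∈I with R? x
    ... | yes x∈R = inj₂ x∈R
    ... | no  x∉R = inj₁ (x∈I , x∉R)

    from : B ∪ R ⊆ I
    from (inj₁ (x∈I , _)) = x∈I
    from (inj₂ (i , refl)) = r∈I i

-- Independence of the code in the strong product.

module ProductProperties {G₁ G₂ : FiniteSimpleGraph} (𝒢₁ : Gadget G₁) (𝒢₂ : Gadget G₂) where
  private
    module G₁ where
      open FiniteSimpleGraph G₁ public
      open GraphProperties G₁ public
    module G₂ where
      open FiniteSimpleGraph G₂ public
      open GraphProperties G₂ public
    module 𝒢₁ where
      open Gadget 𝒢₁ public
      open GadgetProperties 𝒢₁ public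
    module 𝒢₂ where
      open Gadget 𝒢₂ public
      open GadgetProperties 𝒢₂ public

  open FiniteSimpleGraph (G₁ ⊠ G₂)
  open GraphProperties (G₁ ⊠ G₂)
  open Product 𝒢₁ 𝒢₂

  confusable : ∀ {x y} → x ≃ y → proj₁ x G₁.≃ proj₁ y × proj₂ x G₂.≃ proj₂ y
  confusable = Equivalence.to (⊠-≃ G₁ G₂)

  ≃-× : ∀ {x₁ y₁ x₂ y₂} → x₁ G₁.≃ y₁ → x₂ G₂.≃ y₂ → (x₁ , x₂) ≃ (y₁ , y₂)
  ≃-× c₁ c₂ = Equivalence.from (⊠-≃ G₁ G₂) (c₁ , c₂)

  -- The slices of `A-H` and `A-V` by the kind of the auxiliary vertex. The `swap` expresses the
  -- opposite pairing in `K₂`.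
  Horizontal Vertical : Kind → Pred Vertex 0ℓ
  Horizontal k = 𝒢₁.Label k ⟨×⟩ 𝒢₂.Part k
  Vertical   k = 𝒢₁.Part k ⟨×⟩ 𝒢₂.Label (swap k)

  A-H≐⋃Horizontal : A-H ≐ ⋃ Horizontal
  A-H≐⋃Horizontal = to , from
    where
    to : A-H ⊆ ⋃ Horizontal
    to (_ , inj₁ (x∈ , p∈))        = o , p∈ , x∈
    to (_ , inj₂ (inj₁ (x∈ , p∈))) = h , p∈ , x∈
    to (_ , inj₂ (inj₂ (x∈ , p∈))) = v , p∈ , x∈

    from : ⋃ Horizontal ⊆ A-H
    from (o , p∈ , x∈) = proj₁ x∈ , inj₁ (x∈ , p∈)
    from (h , p∈ , x∈) = proj₁ x∈ , inj₂ (inj₁ (x∈ , p∈))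
    from (v , p∈ , x∈) = proj₁ x∈ , inj₂ (inj₂ (x∈ , p∈))

  A-V≐⋃Vertical : A-V ≐ ⋃ Vertical
  A-V≐⋃Vertical = to , from
    where
    to : A-V ⊆ ⋃ Vertical
    to (_ , inj₁ (y∈ , q∈))        = o , y∈ , q∈
    to (_ , inj₂ (inj₁ (y∈ , q∈))) = h , y∈ , q∈
    to (_ , inj₂ (inj₂ (y∈ , q∈))) = v , y∈ , q∈

    from : ⋃ Vertical ⊆ A-V
    from (o , y∈ , q∈) = proj₁ y∈ , inj₁ (y∈ , q∈)
    from (h , y∈ , q∈) = proj₁ y∈ , inj₂ (inj₁ (y∈ , q∈))
    from (v , y∈ , q∈) = proj₁ y∈ , inj₂ (inj₂ (y∈ , q∈))

  -- The first coordinates alone decide: one is in B₁, the other is an endpoint.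
  B×B≄Horizontal : ∀ k {x y} → x ∈ (𝒢₁.B ⟨×⟩ 𝒢₂.B) → y ∈ Horizontal k → ¬ x ≃ y
  B×B≄Horizontal k (b₁ , _) (p∈ , _) c =
    𝒢₁.B≄Endpoint b₁ (𝒢₁.Label⊆Endpoint k p∈) (proj₁ (confusable c))

  B×B≄Vertical : ∀ k {x y} → x ∈ (𝒢₁.B ⟨×⟩ 𝒢₂.B) → y ∈ Vertical k → ¬ x ≃ y
  B×B≄Vertical k (_ , b₂) (_ , q∈) c =
    𝒢₂.B≄Endpoint b₂ (𝒢₂.Label⊆Endpoint (swap k) q∈) (proj₂ (confusable c))

  -- Confusability would force l ≡ k from the first coordinate and k ≡ swap l from the
  -- second, with neither k nor l equal to o.
  Horizontal≄Vertical : ∀ k l {x y} → x ∈ Horizontal k → y ∈ Vertical l → ¬ x ≃ y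
  Horizontal≄Vertical k l (p∈ , x∈) (y∈ , q∈) c = k≢o (swap-fixed (sym k≡swap-k))
    where
    c₁ = G₁.≃-sym (proj₁ (confusable c))
    c₂ = proj₂ (confusable c)

    k≢o : k ≢ o
    k≢o refl = 𝒢₂.O≄Endpoint x∈ (𝒢₂.Label⊆Endpoint (swap l) q∈) c₂

    l≢o : l ≢ o
    l≢o refl = 𝒢₁.O≄Endpoint y∈ (𝒢₁.Label⊆Endpoint k p∈) c₁

    l≡k : l ≡ k
    l≡k = 𝒢₁.Part-unique l k y∈ (𝒢₁.∈-Part k≢o (𝒢₁.Part⊆X l y∈) p∈ c₁)

    k≡swap-k : k ≡ swap k
    k≡swap-k = subst (λ m → k ≡ swap m) l≡k
      (𝒢₂.Part-unique k (swap l) x∈ (𝒢₂.∈-Part (swap≢o l≢o) (𝒢₂.Part⊆X k x∈) q∈ c₂))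

  -- Independence of X₂ makes the second coordinates equal, hence the kinds equal; both first
  -- coordinates then lie in a single independent label set.
  Horizontal⇒≡ : ∀ k l {x y} → x ∈ Horizontal k → y ∈ Horizontal l → x ≃ y → x ≡ y
  Horizontal⇒≡ k l (p∈ , x∈) (p′∈ , x′∈) c
    with refl ← 𝒢₂.X⇒≡ (𝒢₂.Part⊆X k x∈) (𝒢₂.Part⊆X l x′∈) (proj₂ (confusable c))
    with refl ← 𝒢₂.Part-unique k l x∈ x′∈
    = cong (_, _) (𝒢₁.Label⇒≡ k p∈ p′∈ (proj₁ (confusable c)))

  Vertical⇒≡ : ∀ k l {x y} → x ∈ Vertical k → y ∈ Vertical l → x ≃ y → x ≡ y
  Vertical⇒≡ k l (y∈ , q∈) (y′∈ , q′∈) c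
    with refl ← 𝒢₁.X⇒≡ (𝒢₁.Part⊆X k y∈) (𝒢₁.Part⊆X l y′∈) (proj₁ (confusable c))
    with refl ← 𝒢₁.Part-unique k l y∈ y′∈
    = cong (_ ,_) (𝒢₂.Label⇒≡ (swap k) q∈ q′∈ (proj₂ (confusable c)))

  code : Pred Vertex 0ℓ
  code = (𝒢₁.B ⟨×⟩ 𝒢₂.B) ∪ ⋃ Horizontal ∪ ⋃ Vertical

  I₁₂⊆code : I₁₂ ⊆ code
  I₁₂⊆code (inj₁ b)        = inj₁ b
  I₁₂⊆code (inj₂ (inj₁ a)) = inj₂ (inj₁ (proj₁ A-H≐⋃Horizontal a))
  I₁₂⊆code (inj₂ (inj₂ a)) = inj₂ (inj₂ (proj₁ A-V≐⋃Vertical a))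

  code⇒≡ : ∀ {x y} → x ∈ code → y ∈ code → x ≃ y → x ≡ y
  code⇒≡ (inj₁ (x₁ , x₂)) (inj₁ (y₁ , y₂)) c =
    cong₂ _,_ (G₁.independent⇒≡ 𝒢₁.I-independent (proj₁ x₁) (proj₁ y₁) (proj₁ (confusable c)))
              (G₂.independent⇒≡ 𝒢₂.I-independent (proj₁ x₂) (proj₁ y₂) (proj₂ (confusable c)))
  code⇒≡ (inj₁ x) (inj₂ (inj₁ (l , y))) c = contradiction c (B×B≄Horizontal l x y)
  code⇒≡ (inj₁ x) (inj₂ (inj₂ (l , y))) c = contradiction c (B×B≄Vertical l x y)
  code⇒≡ (inj₂ (inj₁ (k , x))) (inj₁ y) c = contradiction (≃-sym c) (B×B≄Horizontal k y x)
  code⇒≡ (inj₂ (inj₁ (k , x))) (inj₂ (inj₁ (l , y))) c = Horizontal⇒≡ k l x y c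
  code⇒≡ (inj₂ (inj₁ (k , x))) (inj₂ (inj₂ (l , y))) c = contradiction c (Horizontal≄Vertical k l x y)
  code⇒≡ (inj₂ (inj₂ (k , x))) (inj₁ y) c = contradiction (≃-sym c) (B×B≄Vertical k y x)
  code⇒≡ (inj₂ (inj₂ (k , x))) (inj₂ (inj₁ (l , y))) c = contradiction (≃-sym c) (Horizontal≄Vertical l k y x)
  code⇒≡ (inj₂ (inj₂ (k , x))) (inj₂ (inj₂ (l , y))) c = Vertical⇒≡ k l x y c

  I₁₂-independent : Independent I₁₂
  I₁₂-independent = ≡⇒independent λ x∈ y∈ → code⇒≡ (I₁₂⊆code x∈) (I₁₂⊆code y∈)

  -- Size of the code.

  card-A-H : ∣ A-H? ∣ ≡ 𝒢₁.t * G₂.∣ 𝒢₂.X? ∣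
  card-A-H = begin
    ∣ A-H? ∣
      ≡⟨ card-⋃ A-H? (λ k → 𝒢₁.Label? k ×? 𝒢₂.Part? k) A-H≐⋃Horizontal
                (λ k l (_ , x∈) (_ , x′∈) → 𝒢₂.Part-unique k l x∈ x′∈) ⟩
    ∣ 𝒢₁.Label? o ×? 𝒢₂.O? ∣ + ∣ 𝒢₁.Label? h ×? 𝒢₂.H? ∣ + ∣ 𝒢₁.Label? v ×? 𝒢₂.V? ∣
      ≡⟨ cong₂ _+_ (cong₂ _+_ (card o) (card h)) (card v) ⟩
    𝒢₁.t * G₂.∣ 𝒢₂.O? ∣ + 𝒢₁.t * G₂.∣ 𝒢₂.H? ∣ + 𝒢₁.t * G₂.∣ 𝒢₂.V? ∣
      ≡⟨ factor 𝒢₁.t G₂.∣ 𝒢₂.O? ∣ G₂.∣ 𝒢₂.H? ∣ G₂.∣ 𝒢₂.V? ∣ ⟩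
    𝒢₁.t * (G₂.∣ 𝒢₂.O? ∣ + G₂.∣ 𝒢₂.H? ∣ + G₂.∣ 𝒢₂.V? ∣)
      ≡⟨ cong (𝒢₁.t *_) 𝒢₂.card-X ⟨
    𝒢₁.t * G₂.∣ 𝒢₂.X? ∣ ∎
    where
    open ≡-Reasoning
    card : ∀ k → ∣ 𝒢₁.Label? k ×? 𝒢₂.Part? k ∣ ≡ 𝒢₁.t * G₂.∣ 𝒢₂.Part? k ∣
    card k = trans (card-× G₁ G₂ (𝒢₁.Label? k) (𝒢₂.Part? k))
                   (cong (_* G₂.∣ 𝒢₂.Part? k ∣) (𝒢₁.card-Label k))

    factor : ∀ t a b c → t * a + t * b + t * c ≡ t * (a + b + c)
    factor = solve-∀

  card-A-V : ∣ A-V? ∣ ≡ G₁.∣ 𝒢₁.X? ∣ * 𝒢₂.t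
  card-A-V = begin
    ∣ A-V? ∣
      ≡⟨ card-⋃ A-V? (λ k → 𝒢₁.Part? k ×? 𝒢₂.Label? (swap k)) A-V≐⋃Vertical
                (λ k l (y∈ , _) (y′∈ , _) → 𝒢₁.Part-unique k l y∈ y′∈) ⟩
    ∣ 𝒢₁.O? ×? 𝒢₂.Label? o ∣ + ∣ 𝒢₁.H? ×? 𝒢₂.Label? v ∣ + ∣ 𝒢₁.V? ×? 𝒢₂.Label? h ∣
      ≡⟨ cong₂ _+_ (cong₂ _+_ (card o) (card h)) (card v) ⟩
    G₁.∣ 𝒢₁.O? ∣ * 𝒢₂.t + G₁.∣ 𝒢₁.H? ∣ * 𝒢₂.t + G₁.∣ 𝒢₁.V? ∣ * 𝒢₂.t
      ≡⟨ factor 𝒢₂.t G₁.∣ 𝒢₁.O? ∣ G₁.∣ 𝒢₁.H? ∣ G₁.∣ 𝒢₁.V? ∣ ⟩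
    (G₁.∣ 𝒢₁.O? ∣ + G₁.∣ 𝒢₁.H? ∣ + G₁.∣ 𝒢₁.V? ∣) * 𝒢₂.t
      ≡⟨ cong (_* 𝒢₂.t) 𝒢₁.card-X ⟨
    G₁.∣ 𝒢₁.X? ∣ * 𝒢₂.t ∎
    where
    open ≡-Reasoning
    card : ∀ k → ∣ 𝒢₁.Part? k ×? 𝒢₂.Label? (swap k) ∣ ≡ G₁.∣ 𝒢₁.Part? k ∣ * 𝒢₂.t
    card k = trans (card-× G₁ G₂ (𝒢₁.Part? k) (𝒢₂.Label? (swap k)))
                   (cong (G₁.∣ 𝒢₁.Part? k ∣ *_) (𝒢₂.card-Label (swap k)))

    factor : ∀ t a b c → a * t + b * t + c * t ≡ (a + b + c) * t
    factor = solve-∀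

  card-I₁₂ : ∣ I₁₂? ∣ ≡ (G₁.∣ 𝒢₁.I? ∣ ∸ 𝒢₁.t) * (G₂.∣ 𝒢₂.I? ∣ ∸ 𝒢₂.t)
                        + 𝒢₁.t * G₂.∣ 𝒢₂.X? ∣ + G₁.∣ 𝒢₁.X? ∣ * 𝒢₂.t
  card-I₁₂ = begin
    ∣ I₁₂? ∣
      ≡⟨ card-∪ I₁₂? (B×B? ∪? A-H?) A-V? (reassoc , unassoc) disjoint ⟩
    ∣ B×B? ∪? A-H? ∣ + ∣ A-V? ∣
      ≡⟨ cong (_+ ∣ A-V? ∣) (card-∪ (B×B? ∪? A-H?) B×B? A-H? (id , id) disjoint′) ⟩
    ∣ B×B? ∣ + ∣ A-H? ∣ + ∣ A-V? ∣
      ≡⟨ cong₂ _+_ (cong₂ _+_ (card-× G₁ G₂ 𝒢₁.B? 𝒢₂.B?) card-A-H) card-A-V ⟩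
    G₁.∣ 𝒢₁.B? ∣ * G₂.∣ 𝒢₂.B? ∣ + 𝒢₁.t * G₂.∣ 𝒢₂.X? ∣ + G₁.∣ 𝒢₁.X? ∣ * 𝒢₂.t
      ≡⟨ cong (λ n → n + 𝒢₁.t * G₂.∣ 𝒢₂.X? ∣ + G₁.∣ 𝒢₁.X? ∣ * 𝒢₂.t) (cong₂ _*_ 𝒢₁.card-B 𝒢₂.card-B) ⟩
    _ ∎
    where
    open ≡-Reasoning
    B×B? = 𝒢₁.B? ×? 𝒢₂.B?

    reassoc : I₁₂ ⊆ ((𝒢₁.B ⟨×⟩ 𝒢₂.B) ∪ A-H) ∪ A-V
    reassoc = [ inj₁ ∘ inj₁ , [ inj₁ ∘ inj₂ , inj₂ ]′ ]′

    unassoc : ((𝒢₁.B ⟨×⟩ 𝒢₂.B) ∪ A-H) ∪ A-V ⊆ I₁₂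
    unassoc = [ [ inj₁ , inj₂ ∘ inj₁ ]′ , inj₂ ∘ inj₂ ]′

    disjoint : ((𝒢₁.B ⟨×⟩ 𝒢₂.B) ∪ A-H) ⊥ A-V
    -- A common vertex would be confusable with itself, so disjointness follows from the
    -- non-confusability lemmas.
    disjoint (inj₁ b , a) with k , x∈ ← proj₁ A-V≐⋃Vertical a = B×B≄Vertical k b x∈ ≃-refl
    disjoint (inj₂ a , a′)
      with k , x∈ ← proj₁ A-H≐⋃Horizontal a | l , x∈′ ← proj₁ A-V≐⋃Vertical a′
      = Horizontal≄Vertical k l x∈ x∈′ ≃-refl

    disjoint′ : (𝒢₁.B ⟨×⟩ 𝒢₂.B) ⊥ A-H
    disjoint′ (b , a) with k , x∈ ← proj₁ A-H≐⋃Horizontal a = B×B≄Horizontal k b x∈ ≃-refl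

  -- Private pairs of the product.

  private
    module O₁ = G₁.Enumeration 𝒢₁.O?
    module O₂ = G₂.Enumeration 𝒢₂.O?

  t₁₂ : ℕ
  t₁₂ = 𝒢₁.t * G₂.∣ 𝒢₂.O? ∣ + G₁.∣ 𝒢₁.O? ∣ * 𝒢₂.t

  Index : Set
  Index = (Fin 𝒢₁.t × Fin G₂.∣ 𝒢₂.O? ∣) ⊎ (Fin G₁.∣ 𝒢₁.O? ∣ × Fin 𝒢₂.t)

  -- `t₁₂` is a sum of two products, so its `Fin` type unfolds into horizontal and vertical pairs;
  -- the constructions are made on `Index` and transported along `decode`.
  indexing : Fin t₁₂ ↔ Index
  indexing = (Fin.*↔× ⊎-↔ Fin.*↔×) ↔-∘ Fin.+↔⊎

  open Inverse indexing using () renaming (to to decode; from to encode)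

  -- Over a vertex of O the code carries the centers of the other gadget, so a copied pair has its
  -- center in the code. Since O meets no neighborhood of an endpoint, the other kind of code points
  -- cannot spoil its privacy.
  r₁₂ q₁₂ : Index → Vertex
  r₁₂ (inj₁ (i , j)) = 𝒢₁.r i , O₂.element j
  r₁₂ (inj₂ (i , j)) = O₁.element i , 𝒢₂.r j
  q₁₂ (inj₁ (i , j)) = 𝒢₁.q i , O₂.element j
  q₁₂ (inj₂ (i , j)) = O₁.element i , 𝒢₂.q j

  r₁₂≃q₁₂ : ∀ a → r₁₂ a ≃ q₁₂ a
  r₁₂≃q₁₂ (inj₁ (i , j)) = ≃-× (𝒢₁.r≃q i) G₂.≃-refl
  r₁₂≃q₁₂ (inj₂ (i , j)) = ≃-× G₁.≃-refl (𝒢₂.r≃q j)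

  r₁₂≢q₁₂ : ∀ a → r₁₂ a ≢ q₁₂ a
  r₁₂≢q₁₂ (inj₁ (i , j)) e = 𝒢₁.r≢q i (cong proj₁ e)
  r₁₂≢q₁₂ (inj₂ (i , j)) e = 𝒢₂.r≢q j (cong proj₂ e)

  r₁₂∈I₁₂ : ∀ a → r₁₂ a ∈ I₁₂
  r₁₂∈I₁₂ (inj₁ (i , j)) = inj₂ (inj₁ (proj₂ A-H≐⋃Horizontal (o , (i , refl) , O₂.element-∈ j)))
  r₁₂∈I₁₂ (inj₂ (i , j)) = inj₂ (inj₂ (proj₂ A-V≐⋃Vertical (o , O₁.element-∈ i , (j , refl))))

  -- For a horizontal pair, `B≄Endpoint` excludes the points of B₁ × B₂ and `O≄Endpoint` the
  -- vertical ones. A horizontal point must share the vertex of O₂, so it has kind `o`, its first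
  -- coordinate is a center, and privacy in the first gadget applies. Vertical pairs are symmetric.
  code-center : ∀ a {x} → x ∈ code → x ≃ q₁₂ a → r₁₂ a ≡ x
  code-center (inj₁ (i , j)) (inj₁ (b , _)) c =
    contradiction (proj₁ (confusable c)) (𝒢₁.B≄Endpoint b (𝒢₁.q∈Endpoint i))
  code-center (inj₁ (i , j)) (inj₂ (inj₁ (k , p∈ , x∈))) c
    with refl ← 𝒢₂.X⇒≡ (𝒢₂.Part⊆X k x∈) (proj₁ (O₂.element-∈ j)) (proj₂ (confusable c))
    with refl ← 𝒢₂.Part-unique o k (O₂.element-∈ j) x∈
    with i′ , refl ← p∈
    = cong (_, _) (𝒢₁.center (𝒢₁.r∈I i′) (proj₁ (confusable c)))
  code-center (inj₁ (i , j)) (inj₂ (inj₂ (k , _ , q∈))) c =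
    contradiction (G₂.≃-sym (proj₂ (confusable c)))
                  (𝒢₂.O≄Endpoint (O₂.element-∈ j) (𝒢₂.Label⊆Endpoint (swap k) q∈))
  code-center (inj₂ (i , j)) (inj₁ (_ , b)) c =
    contradiction (proj₂ (confusable c)) (𝒢₂.B≄Endpoint b (𝒢₂.q∈Endpoint j))
  code-center (inj₂ (i , j)) (inj₂ (inj₁ (k , p∈ , _))) c =
    contradiction (G₁.≃-sym (proj₁ (confusable c)))
                  (𝒢₁.O≄Endpoint (O₁.element-∈ i) (𝒢₁.Label⊆Endpoint k p∈))
  code-center (inj₂ (i , j)) (inj₂ (inj₂ (k , y∈ , q∈))) c
    with refl ← 𝒢₁.X⇒≡ (𝒢₁.Part⊆X k y∈) (proj₁ (O₁.element-∈ i)) (proj₁ (confusable c))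
    with refl ← 𝒢₁.Part-unique o k (O₁.element-∈ i) y∈
    with j′ , refl ← q∈
    = cong (_ ,_) (𝒢₂.center (𝒢₂.r∈I j′) (proj₂ (confusable c)))

  private-pair₁₂ : ∀ a → PrivatePair I₁₂ (r₁₂ a) (q₁₂ a)
  private-pair₁₂ a =
    r₁₂∈I₁₂ a
    -- Confusable with itself, a private neighbor inside the code would equal its own center.
    , (λ q∈ → r₁₂≢q₁₂ a (code-center a (I₁₂⊆code q∈) ≃-refl))
    , (λ { ((_ , refl , c) , x∈) → code-center a (I₁₂⊆code x∈) c })
    , λ { refl → (q₁₂ a , refl , r₁₂≃q₁₂ a) , r₁₂∈I₁₂ a }

  Endpoints₁₂ : Index → Pred Vertex 0ℓ
  Endpoints₁₂ a = ｛ r₁₂ a ｝ ∪ ｛ q₁₂ a ｝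

  Endpoints₁₂-inj₁ : ∀ {i j x} → x ∈ Endpoints₁₂ (inj₁ (i , j)) →
                     proj₁ x ∈ 𝒢₁.Endpoints i × O₂.element j ≡ proj₂ x
  Endpoints₁₂-inj₁ (inj₁ refl) = inj₁ refl , refl
  Endpoints₁₂-inj₁ (inj₂ refl) = inj₂ refl , refl

  Endpoints₁₂-inj₂ : ∀ {i j x} → x ∈ Endpoints₁₂ (inj₂ (i , j)) →
                     O₁.element i ≡ proj₁ x × proj₂ x ∈ 𝒢₂.Endpoints j
  Endpoints₁₂-inj₂ (inj₁ refl) = refl , inj₁ refl
  Endpoints₁₂-inj₂ (inj₂ refl) = refl , inj₂ refl

  -- The first coordinate would be both an endpoint of the first gadget and a vertex of O₁.
  Endpoints₁₂-clash : ∀ {a b x} → x ∉ Endpoints₁₂ (inj₁ a) ∩ Endpoints₁₂ (inj₂ b)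
  Endpoints₁₂-clash {b = i , j} (x∈ , x∈′)
    with y∈ , _ ← Endpoints₁₂-inj₁ x∈ | refl , _ ← Endpoints₁₂-inj₂ x∈′
    = 𝒢₁.O≄Endpoint (O₁.element-∈ i) (_ , y∈) G₁.≃-refl

  Endpoints₁₂-unique : ∀ a b {x} → x ∈ Endpoints₁₂ a → x ∈ Endpoints₁₂ b → a ≡ b
  Endpoints₁₂-unique (inj₁ _) (inj₁ _) x∈ x∈′
    with y∈ , e ← Endpoints₁₂-inj₁ x∈ | y∈′ , e′ ← Endpoints₁₂-inj₁ x∈′
    = cong inj₁ (cong₂ _,_ (𝒢₁.endpoints-unique y∈ y∈′) (O₂.element-injective (trans e (sym e′))))
  Endpoints₁₂-unique (inj₁ _) (inj₂ _) x∈ x∈′ = contradiction (x∈ , x∈′) Endpoints₁₂-clash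
  Endpoints₁₂-unique (inj₂ _) (inj₁ _) x∈ x∈′ = contradiction (x∈′ , x∈) Endpoints₁₂-clash
  Endpoints₁₂-unique (inj₂ _) (inj₂ _) x∈ x∈′
    with e , y∈ ← Endpoints₁₂-inj₂ x∈ | e′ , y∈′ ← Endpoints₁₂-inj₂ x∈′
    = cong inj₂ (cong₂ _,_ (O₁.element-injective (trans e (sym e′))) (𝒢₂.endpoints-unique y∈ y∈′))

  -- Transversals of the product.

  Transversal : Kind → Pred Vertex 0ℓ
  Transversal k = (𝒢₁.Label k ⟨×⟩ 𝒢₂.O) ∪ (𝒢₁.O ⟨×⟩ 𝒢₂.Label (swap k))

  Transversal? : ∀ k → Decidable (Transversal k)
  Transversal? k = (𝒢₁.Label? k ×? 𝒢₂.O?) ∪? (𝒢₁.O? ×? 𝒢₂.Label? (swap k))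

  Transversal-endpoints : ∀ k {x} → x ∈ Transversal k → ∃[ a ] x ∈ Endpoints₁₂ a
  Transversal-endpoints k (inj₁ (p∈ , x∈))
    with 𝒢₁.Label⊆Endpoint k p∈ | O₂.element-surjective x∈
  ... | i , inj₁ refl | j , refl = inj₁ (i , j) , inj₁ refl
  ... | i , inj₂ refl | j , refl = inj₁ (i , j) , inj₂ refl
  Transversal-endpoints k (inj₂ (y∈ , q∈))
    with O₁.element-surjective y∈ | 𝒢₂.Label⊆Endpoint (swap k) q∈
  ... | i , refl | j , inj₁ refl = inj₂ (i , j) , inj₁ refl
  ... | i , refl | j , inj₂ refl = inj₂ (i , j) , inj₂ refl

  transversal₁₂ : ∀ a → (r₁₂ a ∈ Transversal h × q₁₂ a ∈ Transversal v)
                      ⊎ (q₁₂ a ∈ Transversal h × r₁₂ a ∈ Transversal v)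
  transversal₁₂ (inj₁ (i , j)) with 𝒢₁.transversal i
  ... | inj₁ (r∈ , q∈) = inj₁ (inj₁ (r∈ , O₂.element-∈ j) , inj₁ (q∈ , O₂.element-∈ j))
  ... | inj₂ (q∈ , r∈) = inj₂ (inj₁ (q∈ , O₂.element-∈ j) , inj₁ (r∈ , O₂.element-∈ j))
  -- On vertical pairs the roles of the transversals of the second gadget are exchanged, so the two
  -- alternatives trade places.
  transversal₁₂ (inj₂ (i , j)) with 𝒢₂.transversal j
  ... | inj₁ (r∈ , q∈) = inj₂ (inj₂ (O₁.element-∈ i , q∈) , inj₂ (O₁.element-∈ i , r∈))
  ... | inj₂ (q∈ , r∈) = inj₁ (inj₂ (O₁.element-∈ i , r∈) , inj₂ (O₁.element-∈ i , q∈))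

  -- Within one summand both factors are independent. Across summands the first coordinates are an
  -- endpoint and a vertex of O₁.
  Transversal-independent : ∀ k → Independent (Transversal k)
  Transversal-independent k = ≡⇒independent eq
    where
    eq : ∀ {x y} → x ∈ Transversal k → y ∈ Transversal k → x ≃ y → x ≡ y
    eq (inj₁ (p∈ , x∈)) (inj₁ (p′∈ , x′∈)) c =
      cong₂ _,_ (𝒢₁.Label⇒≡ k p∈ p′∈ (proj₁ (confusable c)))
                (𝒢₂.X⇒≡ (proj₁ x∈) (proj₁ x′∈) (proj₂ (confusable c)))
    eq (inj₁ (p∈ , _)) (inj₂ (y∈ , _)) c =
      contradiction (G₁.≃-sym (proj₁ (confusable c))) (𝒢₁.O≄Endpoint y∈ (𝒢₁.Label⊆Endpoint k p∈))
    eq (inj₂ (y∈ , _)) (inj₁ (p∈ , _)) c =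
      contradiction (proj₁ (confusable c)) (𝒢₁.O≄Endpoint y∈ (𝒢₁.Label⊆Endpoint k p∈))
    eq (inj₂ (y∈ , q∈)) (inj₂ (y′∈ , q′∈)) c =
      cong₂ _,_ (𝒢₁.X⇒≡ (proj₁ y∈) (proj₁ y′∈) (proj₁ (confusable c)))
                (𝒢₂.Label⇒≡ (swap k) q∈ q′∈ (proj₂ (confusable c)))

  -- Auxiliary set of the product and its classes.

  X₁₂ : Pred Vertex 0ℓ
  X₁₂ = 𝒢₁.X ⟨×⟩ 𝒢₂.X

  X₁₂-independent : Independent X₁₂
  X₁₂-independent = ≡⇒independent λ (x₁ , x₂) (y₁ , y₂) c →
    cong₂ _,_ (𝒢₁.X⇒≡ x₁ y₁ (proj₁ (confusable c))) (𝒢₂.X⇒≡ x₂ y₂ (proj₂ (confusable c)))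

  -- For `h` and `v` these are the classes H and V of the product. Its class O differs from
  -- `Part₁₂ o`: it also contains (H₁ ∪ V₁) × (H₂ ∪ V₂).
  Part₁₂ : Kind → Pred Vertex 0ℓ
  Part₁₂ k = (𝒢₁.Part k ⟨×⟩ 𝒢₂.O) ∪ (𝒢₁.O ⟨×⟩ 𝒢₂.Part (swap k))

  -- One coordinate of a transversal point lies in O, hence in X, so independence of X makes it
  -- equal to the matching coordinate of the neighbor. The other coordinate is then classified by
  -- its label.
  X₁₂∩N-Transversal : ∀ {k} → k ≢ o → X₁₂ ∩ N (Transversal k) ≐ Part₁₂ k
  X₁₂∩N-Transversal {k} k≢o = to , from
    where
    to : X₁₂ ∩ N (Transversal k) ⊆ Part₁₂ k
    to ((x₁∈ , x₂∈) , _ , inj₁ (p∈ , x∈) , c)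
      with refl ← 𝒢₂.X⇒≡ x₂∈ (proj₁ x∈) (proj₂ (confusable c))
      = inj₁ (𝒢₁.∈-Part k≢o x₁∈ p∈ (proj₁ (confusable c)) , x∈)
    to ((x₁∈ , x₂∈) , _ , inj₂ (y∈ , q∈) , c)
      with refl ← 𝒢₁.X⇒≡ x₁∈ (proj₁ y∈) (proj₁ (confusable c))
      = inj₂ (y∈ , 𝒢₂.∈-Part (swap≢o k≢o) x₂∈ q∈ (proj₂ (confusable c)))

    from : Part₁₂ k ⊆ X₁₂ ∩ N (Transversal k)
    from (inj₁ (x₁∈ , x₂∈)) with p , p∈ , c ← 𝒢₁.Part⊆N-Label k≢o x₁∈ =
      (𝒢₁.Part⊆X k x₁∈ , proj₁ x₂∈) , (p , _) , inj₁ (p∈ , x₂∈) , ≃-× c G₂.≃-refl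
    from (inj₂ (x₁∈ , x₂∈)) with q , q∈ , c ← 𝒢₂.Part⊆N-Label (swap≢o k≢o) x₂∈ =
      (proj₁ x₁∈ , 𝒢₂.Part⊆X (swap k) x₂∈) , (_ , q) , inj₂ (x₁∈ , q∈) , ≃-× G₁.≃-refl c

  Part₁₂-disjoint : Part₁₂ h ⊥ Part₁₂ v
  Part₁₂-disjoint (inj₁ (x , _) , inj₁ (y , _)) = contradiction (𝒢₁.Part-unique h v x y) λ ()
  Part₁₂-disjoint (inj₁ (x , _) , inj₂ (y , _)) = contradiction (𝒢₁.Part-unique h o x y) λ ()
  Part₁₂-disjoint (inj₂ (x , _) , inj₁ (y , _)) = contradiction (𝒢₁.Part-unique o v x y) λ ()
  Part₁₂-disjoint (inj₂ (_ , x) , inj₂ (_ , y)) = contradiction (𝒢₂.Part-unique v h x y) λ ()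

  -- `S?` is arbitrary so that the count applies to `H?` and `V?` of the assembled gadget, which
  -- decide membership by a neighborhood search.
  card-Part₁₂ : ∀ {k} → k ≢ o → {S : Pred Vertex 0ℓ} (S? : Decidable S) → S ≐ X₁₂ ∩ N (Transversal k) →
                ∣ S? ∣ ≡ G₁.∣ 𝒢₁.Part? k ∣ * G₂.∣ 𝒢₂.O? ∣ + G₁.∣ 𝒢₁.O? ∣ * G₂.∣ 𝒢₂.Part? (swap k) ∣
  card-Part₁₂ {k} k≢o S? (S⊆ , ⊆S) =
    trans (card-∪ S? (𝒢₁.Part? k ×? 𝒢₂.O?) (𝒢₁.O? ×? 𝒢₂.Part? (swap k))
            (proj₁ (X₁₂∩N-Transversal k≢o) ∘ S⊆ , ⊆S ∘ proj₂ (X₁₂∩N-Transversal k≢o))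
            λ ((x∈ , _) , (y∈ , _)) → k≢o (𝒢₁.Part-unique k o x∈ y∈))
          (cong₂ _+_ (card-× G₁ G₂ (𝒢₁.Part? k) 𝒢₂.O?) (card-× G₁ G₂ 𝒢₁.O? (𝒢₂.Part? (swap k))))

  -- Assembly of the product gadget.

  gadget : Gadget (G₁ ⊠ G₂)
  gadget = record
    { I                  = I₁₂
    ; I?                 = I₁₂?
    ; I-independent      = I₁₂-independent
    ; t                  = t₁₂
    ; r                  = r₁₂ ∘ decode
    ; q                  = q₁₂ ∘ decode
    ; private-pair       = private-pair₁₂ ∘ decode
    ; endpoints-disjoint = λ i≢j (x∈ , x∈′) →
        i≢j (Injection.injective (↔⇒↣ indexing) (Endpoints₁₂-unique _ _ x∈ x∈′))
    ; PH                 = Transversal h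
    ; PV                 = Transversal v
    ; PH?                = Transversal? h
    ; PV?                = Transversal? v
    ; PH-endpoints       = encoded ∘ Transversal-endpoints h
    ; PV-endpoints       = encoded ∘ Transversal-endpoints v
    ; transversal        = transversal₁₂ ∘ decode
    ; PH-independent     = Transversal-independent h
    ; PV-independent     = Transversal-independent v
    ; X                  = X₁₂
    ; X?                 = 𝒢₁.X? ×? 𝒢₂.X?
    ; X-independent      = X₁₂-independent
    ; X-separated        = λ _ (x∈ , x∈H , x∈V) →
        Part₁₂-disjoint ( proj₁ (X₁₂∩N-Transversal {h} λ ()) (x∈ , x∈H)
                        , proj₁ (X₁₂∩N-Transversal {v} λ ()) (x∈ , x∈V) )
    }
    where
    encoded : ∀ {x} → ∃[ a ] x ∈ Endpoints₁₂ a → ∃[ i ] x ∈ Endpoints₁₂ (decode i)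
    -- `decode (encode a)` equals `a` only propositionally, hence the transport.
    encoded {x} (a , x∈) =
      encode a , subst (λ b → x ∈ Endpoints₁₂ b) (sym (Inverse.strictlyInverseˡ indexing a)) x∈

  -- Parameters of the product gadget.

  private
    module 𝒢₁₂ where
      open Gadget gadget public
      open GadgetProperties gadget public

  o₁ = G₁.∣ 𝒢₁.O? ∣
  h₁ = G₁.∣ 𝒢₁.H? ∣
  v₁ = G₁.∣ 𝒢₁.V? ∣
  o₂ = G₂.∣ 𝒢₂.O? ∣
  h₂ = G₂.∣ 𝒢₂.H? ∣
  v₂ = G₂.∣ 𝒢₂.V? ∣

  card-H₁₂ : ∣ 𝒢₁₂.H? ∣ ≡ h₁ * o₂ + o₁ * v₂
  -- The class H of `gadget` unfolds to `X₁₂ ∩ N (Transversal h)`, so both inclusions are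
  -- identities.
  card-H₁₂ = card-Part₁₂ {h} (λ ()) 𝒢₁₂.H? (id , id)

  card-V₁₂ : ∣ 𝒢₁₂.V? ∣ ≡ v₁ * o₂ + o₁ * h₂
  card-V₁₂ = card-Part₁₂ {v} (λ ()) 𝒢₁₂.V? (id , id)

  card-X₁₂ : ∣ 𝒢₁₂.X? ∣ ≡ G₁.∣ 𝒢₁.X? ∣ * G₂.∣ 𝒢₂.X? ∣
  card-X₁₂ = card-× G₁ G₂ 𝒢₁.X? 𝒢₂.X?

  -- Adding h₁₂ + v₁₂ turns both sides into s₁ s₂.
  card-O₁₂ : ∣ 𝒢₁₂.O? ∣ ≡ o₁ * o₂ + (h₁ + v₁) * (h₂ + v₂)
  card-O₁₂ = +-cancelʳ-≡ v₁₂ _ _ (+-cancelʳ-≡ h₁₂ _ _ (begin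
    ∣ 𝒢₁₂.O? ∣ + v₁₂ + h₁₂
      ≡⟨ exchange ∣ 𝒢₁₂.O? ∣ v₁₂ h₁₂ ⟩
    ∣ 𝒢₁₂.O? ∣ + h₁₂ + v₁₂
      ≡⟨ cong₂ (λ m n → ∣ 𝒢₁₂.O? ∣ + m + n) card-H₁₂ card-V₁₂ ⟨
    ∣ 𝒢₁₂.O? ∣ + ∣ 𝒢₁₂.H? ∣ + ∣ 𝒢₁₂.V? ∣
      ≡⟨ 𝒢₁₂.card-X ⟨
    ∣ 𝒢₁₂.X? ∣
      ≡⟨ card-X₁₂ ⟩
    G₁.∣ 𝒢₁.X? ∣ * G₂.∣ 𝒢₂.X? ∣
      ≡⟨ cong₂ _*_ 𝒢₁.card-X 𝒢₂.card-X ⟩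
    (o₁ + h₁ + v₁) * (o₂ + h₂ + v₂)
      ≡⟨ expand o₁ h₁ v₁ o₂ h₂ v₂ ⟩
    o₁ * o₂ + (h₁ + v₁) * (h₂ + v₂) + v₁₂ + h₁₂ ∎))
    where
    open ≡-Reasoning
    h₁₂ = h₁ * o₂ + o₁ * v₂
    v₁₂ = v₁ * o₂ + o₁ * h₂

    exchange : ∀ a b c → a + b + c ≡ a + c + b
    exchange = solve-∀

    expand : ∀ o₁ h₁ v₁ o₂ h₂ v₂ → (o₁ + h₁ + v₁) * (o₂ + h₂ + v₂) ≡
      o₁ * o₂ + (h₁ + v₁) * (h₂ + v₂) + (v₁ * o₂ + o₁ * h₂) + (h₁ * o₂ + o₁ * v₂)
    expand = solve-∀

lemma4 : (G₁ G₂ : FiniteSimpleGraph) (𝒢₁ : Gadget G₁) (𝒢₂ : Gadget G₂) →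
  let open FiniteSimpleGraph (G₁ ⊠ G₂)
      open Product 𝒢₁ 𝒢₂
      (a₁ , t₁ , s₁ , o₁ , h₁ , v₁) = Gadget.parameters 𝒢₁
      (a₂ , t₂ , s₂ , o₂ , h₂ , v₂) = Gadget.parameters 𝒢₂
  in Independent I₁₂
     × ∣ I₁₂? ∣ ≡ (a₁ ∸ t₁) * (a₂ ∸ t₂) + t₁ * s₂ + s₁ * t₂
     × (∃[ 𝒢₁₂ ] (Gadget.I {G₁ ⊠ G₂} 𝒢₁₂ ≐ I₁₂
         × Gadget.parameters 𝒢₁₂ ≡
             ( ∣ I₁₂? ∣
             , t₁ * o₂ + o₁ * t₂
             , s₁ * s₂
             , o₁ * o₂ + (h₁ + v₁) * (h₂ + v₂)
             , h₁ * o₂ + o₁ * v₂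
             , v₁ * o₂ + o₁ * h₂ )))
lemma4 G₁ G₂ 𝒢₁ 𝒢₂ =
  I₁₂-independent , card-I₁₂ , gadget , (id , id) ,
  -- The code size and the number of pairs agree by computation; only the last four parameters need
  -- proofs.
  cong (λ p → ∣ I₁₂? ∣ , t₁₂ , p)
       (cong₂ _,_ card-X₁₂ (cong₂ _,_ card-O₁₂ (cong₂ _,_ card-H₁₂ card-V₁₂)))
  where
  open ProductProperties 𝒢₁ 𝒢₂
  open Product 𝒢₁ 𝒢₂ using (I₁₂?)
  open FiniteSimpleGraph (G₁ ⊠ G₂) using (∣_∣)
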